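{- Let $q$ be a prime power. A regular spread of $\mathsf{W}_3(q)$ with a line removed is a neighbour-transitive code of size $q^2$.
   Context: $\mathsf{W}_3(q)$: let $V=\mathbb{F}_q^4$ be equipped with a non-degenerate symplectic bilinear form $f$. Points are the $1$-dimensional subspaces of $V$, lines are the totally isotropic $2$-dimensional subspaces of $V$, incidence is symmetrised containment. Its point-line incidence graph $\varGamma$ has all points and lines as vertices, with adjacency given by incidence. A spread of $\mathsf{W}_3(q)$ is a set of lines such that each point is incident with exactly one of them. It is regular (Desarguesian) if it is obtained by field reduction, i.e. there is a $2$-dimensional $\mathbb{F}_{q^2}$-vector space structure on $V$ extending its $\mathbb{F}_q$-structure such that the spread is the set of all $1$-dimensional $\mathbb{F}_{q^2}$-subspaces of $V$. A code $C$ is a subset of the vertex set of $\varGamma$; $C_1$ is the set of vertices not in $C$ that are adjacent to some element of $C$; $\operatorname{Aut}(C)$ is the setwise stabiliser of $C$ in $\operatorname{Aut}(\varGamma)$; $C$ is neighbour-transitive if $\operatorname{Aut}(C)$ acts transitively on each of $C$ and $C_1$. -}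

module Defs where

open import Algebra.Apartness.Bundles using (HeytingField; HeytingCommutativeRing)
open import Algebra.Bundles using (CommutativeRing; Ring)
open import Algebra.Module.Bundles using (LeftModule)
open import Algebra.Module.Morphism.Structures using (module LeftModuleMorphisms)
open import Algebra.Morphism.Structures using (module RingMorphisms)
open import Algebra.Module.Structures using (IsLeftModule)
import Algebra.Module.Construct.TensorUnit as TensorUnit
import Algebra.Properties.Monoid.Sum as Sum
open import Data.Empty using (⊥)
open import Data.Fin.Base using (Fin)
open import Data.Nat.Base using (ℕ; suc; _^_)
open import Data.Nat.Primality using (Prime)
open import Data.Product using (Σ; ∃!; ∃-syntax; ∃₂; _×_; _,_; proj₁; proj₂)
open import Data.Sum.Base using (_⊎_; inj₁; inj₂)
open import Data.Sum.Relation.Binary.Pointwise using (_⊎ₛ_; inj₁; inj₂)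
open import Data.Vec.Functional using (Vector)
import Data.Vec.Functional.Relation.Binary.Equality.Setoid as VectorEquality
open import Function.Base using (_∘_)
open import Function.Bundles using (Inverse; _⇔_)
open import Level using (Level; 0ℓ; _⊔_) renaming (suc to lsuc)
open import Relation.Binary.Bundles using (Setoid)
open import Relation.Binary.Core using (Rel)
open import Relation.Binary.Definitions using (Symmetric; Irreflexive; _Respects_; _Respectsʳ_)
import Relation.Binary.Construct.On as On
open import Relation.Binary.PropositionalEquality using (_≡_)
import Relation.Binary.PropositionalEquality as ≡
open import Relation.Nullary.Negation using (¬_)
open import Relation.Unary using (Pred; U; _≐_; _⊆_)
open import Relation.Unary.Relation.Binary.Equality using (≐-setoid)

private
  variable
    a ℓ p : Level

IsPrimePower : ℕ → Set
IsPrimePower q = ∃₂ λ r k → Prime r × q ≡ r ^ suc k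

HasSize : Setoid a ℓ → ℕ → Set (a ⊔ ℓ)
HasSize A n = Inverse A (≡.setoid (Fin n))

record Subset (A : Setoid a ℓ) (p : Level) : Set (a ⊔ ℓ ⊔ lsuc p) where
  open Setoid A
  field
    Member  : Pred Carrier p
    respect : Member Respects _≈_

infix 4 _∈_ _∉_

_∈_ : {A : Setoid a ℓ} → Setoid.Carrier A → Subset A p → Set p
x ∈ X = Subset.Member X x

_∉_ : {A : Setoid a ℓ} → Setoid.Carrier A → Subset A p → Set p
x ∉ X = ¬ (x ∈ X)

elements : {A : Setoid a ℓ} → Subset A p → Setoid (a ⊔ p) ℓ
elements {A = A} X = On.setoid {B = Σ (Setoid.Carrier A) (Subset.Member X)} A proj₁

-- Tightness of the apartness relation excludes the trivial ring, and over a
-- finite carrier (where equality is decidable) a Heyting field is the same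
-- thing as a field.

Field : Set₁
Field = HeytingField 0ℓ 0ℓ 0ℓ

module _ (K : Field) where

  fieldRing : Ring 0ℓ 0ℓ
  fieldRing = CommutativeRing.ring
    (HeytingCommutativeRing.commutativeRing (HeytingField.heytingCommutativeRing K))

  fieldSetoid : Setoid 0ℓ 0ℓ
  fieldSetoid = Ring.setoid fieldRing

  VectorSpace : Set₁
  VectorSpace = LeftModule fieldRing 0ℓ 0ℓ

  coordinateSpace : ℕ → VectorSpace
  coordinateSpace n = record
    { Carrierᴹ = Vector Carrier n
    ; _≈ᴹ_ = _≋_
    ; _+ᴹ_ = λ u v i → u i + v i
    ; _*ₗ_ = λ x v i → x * v i
    ; 0ᴹ = λ _ → 0#
    ; -ᴹ_ = λ v i → - v i
    ; isLeftModule = record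
      { isLeftSemimodule = record
        { +ᴹ-isCommutativeMonoid = record
          { isMonoid = record
            { isSemigroup = record
              { isMagma = record
                { isEquivalence = ≋-isEquivalence n
                ; ∙-cong = λ u≋u′ v≋v′ i → +-cong (u≋u′ i) (v≋v′ i)
                }
              ; assoc = λ u v w i → +-assoc (u i) (v i) (w i)
              }
            ; identity = (λ v i → +-identityˡ (v i)) , (λ v i → +-identityʳ (v i))
            }
          ; comm = λ u v i → +-comm (u i) (v i)
          }
        ; isPreleftSemimodule = record
          { *ₗ-cong = λ x≈y u≋v i → *-cong x≈y (u≋v i)
          ; *ₗ-zeroˡ = λ v i → zeroˡ (v i)
          ; *ₗ-distribʳ = λ v x y i → distribʳ (v i) x y
          ; *ₗ-identityˡ = λ v i → *-identityˡ (v i)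
          ; *ₗ-assoc = λ x y v i → *-assoc x y (v i)
          ; *ₗ-zeroʳ = λ x i → zeroʳ x
          ; *ₗ-distribˡ = λ x u v i → distribˡ x (u i) (v i)
          }
        }
      ; -ᴹ‿cong = λ u≋v i → -‿cong (u≋v i)
      ; -ᴹ‿inverse = (λ v i → -‿inverseˡ (v i)) , (λ v i → -‿inverseʳ (v i))
      }
    }
    where
    open Ring fieldRing
    open VectorEquality fieldSetoid using (_≋_; ≋-isEquivalence)

module _ (K : Field) (V : VectorSpace K) where

  private
    module K = Ring (fieldRing K)

  open LeftModule V
  open Sum +ᴹ-monoid using (sum)

  linearCombination : ∀ {n} → Vector K.Carrier n → Vector Carrierᴹ n → Carrierᴹ
  linearCombination x b = sum (λ i → x i *ₗ b i)

  LinearlyIndependent : ∀ {n} → Vector Carrierᴹ n → Set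
  LinearlyIndependent b = ∀ x → linearCombination x b ≈ᴹ 0ᴹ → ∀ i → x i K.≈ K.0#

  record IsSubspace (W : Pred Carrierᴹ 0ℓ) : Set where
    field
      resp      : W Respects _≈ᴹ_
      0∈        : W 0ᴹ
      +-closed  : ∀ {u v} → W u → W v → W (u +ᴹ v)
      *ₗ-closed : ∀ x {v} → W v → W (x *ₗ v)

  record HasDimension (W : Pred Carrierᴹ 0ℓ) (n : ℕ) : Set where
    field
      basis       : Vector Carrierᴹ n
      basis∈W     : ∀ i → W (basis i)
      independent : LinearlyIndependent basis
      spanning    : ∀ {v} → W v → ∃[ x ] v ≈ᴹ linearCombination x basis

  record SymplecticForm : Set where
    open LeftModuleMorphisms rawLeftModule
      (LeftModule.rawLeftModule (TensorUnit.leftModule {R = fieldRing K}))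
      using (IsLeftModuleHomomorphism)
    field
      form          : Carrierᴹ → Carrierᴹ → K.Carrier
      linearˡ       : ∀ v → IsLeftModuleHomomorphism (λ u → form u v)
      linearʳ       : ∀ u → IsLeftModuleHomomorphism (form u)
      alternating   : ∀ v → form v v K.≈ K.0#
      nondegenerate : ∀ u → (∀ v → form u v K.≈ K.0#) → u ≈ᴹ 0ᴹ

record Graph : Set₂ where
  field
    vertices : Setoid (lsuc 0ℓ) (lsuc 0ℓ)
  open Setoid vertices public using (_≈_) renaming (Carrier to Vertex)
  infix 4 _~_
  field
    _~_      : Rel Vertex 0ℓ
    ~-respʳ  : _~_ Respectsʳ _≈_
    ~-sym    : Symmetric _~_
    ~-irrefl : Irreflexive _≈_ _~_

module _ (Γ : Graph) where

  open Graph Γ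

  record Automorphism : Set₁ where
    field
      permutation : Inverse vertices vertices
    open Inverse permutation public using (to; from)
    field
      adjacency : ∀ u v → u ~ v ⇔ to u ~ to v

  open Automorphism using (to)

  Code : Set₁
  Code = Subset vertices 0ℓ

  neighbours : Code → Subset vertices (lsuc 0ℓ)
  neighbours C = record
    { Member  = λ v → v ∉ C × ∃[ c ] (c ∈ C × c ~ v)
    ; respect = λ { v≈w (v∉C , c , c∈C , c~v) →
        v∉C ∘ Subset.respect C (Setoid.sym vertices v≈w) , c , c∈C , ~-respʳ v≈w c~v }
    }

  Stabilises : Automorphism → Code → Set₁
  Stabilises g C = ∀ v → v ∈ C ⇔ to g v ∈ C

  StabiliserTransitiveOn : Code → Subset vertices p → Set (lsuc 0ℓ ⊔ p)
  StabiliserTransitiveOn C X =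
    ∀ {x y} → x ∈ X → y ∈ X → ∃[ g ] (Stabilises g C × to g x ≈ y)

  IsNeighbourTransitive : Code → Set₁
  IsNeighbourTransitive C = StabiliserTransitiveOn C C × StabiliserTransitiveOn C (neighbours C)

-- An L-vector space structure, with L a field of order q², on the additive group
-- of the K-vector space V (with K of order q) whose restriction along ι is the
-- given K-structure.

record FieldReduction (K : Field) (V : VectorSpace K) (q : ℕ) : Set₁ where
  private
    module V = LeftModule V
  field
    L       : Field
    L-size  : HasSize (fieldSetoid L) (q ^ 2)
  open RingMorphisms (Ring.rawRing (fieldRing K)) (Ring.rawRing (fieldRing L))
    using (IsRingHomomorphism)
  infixr 7 _·_
  field
    ι            : HeytingField.Carrier K → HeytingField.Carrier L
    ι-homo       : IsRingHomomorphism ι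
    _·_          : HeytingField.Carrier L → V.Carrierᴹ → V.Carrierᴹ
    isLeftModule : IsLeftModule (fieldRing L) V._≈ᴹ_ V._+ᴹ_ V.0ᴹ V.-ᴹ_ _·_
    extends      : ∀ x v → ι x · v V.≈ᴹ x V.*ₗ v

  reduced : VectorSpace L
  reduced = record { isLeftModule = isLeftModule }

  field
    dimension : HasDimension L reduced U 2

module W₃ (K : Field) (f : SymplecticForm K (coordinateSpace K 4)) where

  private
    V : VectorSpace K
    V = coordinateSpace K 4

  open LeftModule V using (Carrierᴹ)
  open SymplecticForm f using (form)
  open HeytingField K using (0#) renaming (_≈_ to _≈ᴷ_)

  record Point : Set₁ where
    field
      carrier    : Pred Carrierᴹ 0ℓ
      isSubspace : IsSubspace K V carrier
      dimension  : HasDimension K V carrier 1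

  record Line : Set₁ where
    field
      carrier    : Pred Carrierᴹ 0ℓ
      isSubspace : IsSubspace K V carrier
      dimension  : HasDimension K V carrier 2
      isotropic  : ∀ {u v} → carrier u → carrier v → form u v ≈ᴷ 0#

  -- Equality of points and of lines is equality of the underlying sets of
  -- vectors, irrespective of the chosen bases.

  points : Setoid (lsuc 0ℓ) 0ℓ
  points = On.setoid (≐-setoid Carrierᴹ 0ℓ) Point.carrier

  lines : Setoid (lsuc 0ℓ) 0ℓ
  lines = On.setoid (≐-setoid Carrierᴹ 0ℓ) Line.carrier

  open Setoid lines using () renaming (_≈_ to _≈ˡ_)

  infix 4 _on_
  _on_ : Point → Line → Set
  P on l = Point.carrier P ⊆ Line.carrier l

  Adjacent : Rel (Point ⊎ Line) 0ℓ
  Adjacent (inj₁ P) (inj₂ l) = P on l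
  Adjacent (inj₂ l) (inj₁ P) = P on l
  Adjacent (inj₁ _) (inj₁ _) = ⊥
  Adjacent (inj₂ _) (inj₂ _) = ⊥

  incidenceGraph : Graph
  incidenceGraph = record
    { vertices = points ⊎ₛ lines
    ; _~_      = Adjacent
    ; ~-respʳ  = λ {u} {v} {w} → respʳ {u} {v} {w}
    ; ~-sym    = λ {u} {v} → symmetric {u} {v}
    ; ~-irrefl = λ {u} {v} → irreflexive {u} {v}
    }
    where
    open Setoid (points ⊎ₛ lines) using (_≈_)

    respʳ : Adjacent Respectsʳ _≈_
    respʳ {inj₁ _} (inj₂ l≈m) P⊆l = λ v∈P → proj₁ l≈m (P⊆l v∈P)
    respʳ {inj₂ _} (inj₁ P≈Q) P⊆l = λ v∈Q → P⊆l (proj₂ P≈Q v∈Q)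
    respʳ {inj₁ _} (inj₁ _) ()
    respʳ {inj₂ _} (inj₂ _) ()

    symmetric : Symmetric Adjacent
    symmetric {inj₁ _} {inj₂ _} P⊆l = P⊆l
    symmetric {inj₂ _} {inj₁ _} P⊆l = P⊆l
    symmetric {inj₁ _} {inj₁ _} ()
    symmetric {inj₂ _} {inj₂ _} ()

    irreflexive : Irreflexive _≈_ Adjacent
    irreflexive (inj₁ _) ()
    irreflexive (inj₂ _) ()

  LineSet : Set₁
  LineSet = Subset lines 0ℓ

  IsSpread : LineSet → Set₁
  IsSpread S = ∀ P → ∃! _≈ˡ_ (λ l → l ∈ S × P on l)

  IsRegular : ℕ → LineSet → Set₁
  IsRegular q S = Σ (FieldReduction K V q) λ R →
    let open FieldReduction R using (L; reduced) in
    (∀ {l} → l ∈ S →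
      IsSubspace L reduced (Line.carrier l) × HasDimension L reduced (Line.carrier l) 1) ×
    (∀ {W} → IsSubspace L reduced W → HasDimension L reduced W 1 →
      ∃[ l ] (l ∈ S × Line.carrier l ≐ W))

  removeLine : LineSet → Line → Code incidenceGraph
  removeLine S l = record { Member = member ; respect = respects }
    where
    open Setoid (points ⊎ₛ lines) using (_≈_)

    member : Pred (Point ⊎ Line) 0ℓ
    member (inj₁ _) = ⊥
    member (inj₂ m) = m ∈ S × ¬ (m ≈ˡ l)

    respects : member Respects _≈_
    respects (inj₁ _) ()
    respects {inj₂ m} {inj₂ n} (inj₂ m≈n) (m∈S , m≉l) =
      Subset.respect S {m} {n} m≈n m∈S ,
      (λ n≈l → m≉l (Setoid.trans lines {m} {n} {l} m≈n n≈l))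

{-# OPTIONS --safe #-}

-- Let L be the field of order q² and det the determinant of the L-plane V in
-- some basis (b₀ , b₁).  Every spread line L v is totally isotropic, so
-- f (v , a v) = 0 for all a in L; polarising, every a is self-adjoint for f, and
-- hence f (v , w) = f (b₀ , det (v , w) b₁).  Thus every L-linear map of
-- determinant 1 is an isometry, and it permutes the spread.  If the removed line
-- is l = L e and u , u′ are vectors off l, then suitable multiples e₁ , e₂ of e
-- satisfy det (e₁ , u) = det (e₂ , u′) = 1, so e₁ ↦ e₂ , u ↦ u′ is such a map and
-- fixes l.  The stabiliser is therefore transitive on the vectors off l, which
-- gives both transitivity claims.  The q² remaining lines correspond to the
-- points of the affine line e⊥ + L e, where det (e , e⊥) = 1.

module Submission where

open import Algebra.Apartness.Bundles using (HeytingField; HeytingCommutativeRing)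
import Algebra.Apartness.Properties.HeytingCommutativeRing as ApartnessProperties
open import Algebra.Bundles using (CommutativeMonoid; CommutativeRing)
open import Algebra.Module.Bundles using (LeftModule)
open import Algebra.Module.Morphism.Structures using (module LeftModuleMorphisms)
import Algebra.Properties.CommutativeSemigroup as CommutativeSemigroupProperties
import Algebra.Properties.Group as GroupProperties
import Algebra.Properties.Monoid.Sum as Sum
import Algebra.Properties.Ring as RingProperties
import Algebra.Solver.Ring.NaturalCoefficients.Default as SemiringSolver
open import Data.Empty using (⊥-elim)
open import Data.Fin.Base using (zero; suc)
import Data.Fin.Properties as Fin
open import Data.Nat.Base using (ℕ; zero; suc; _^_)
open import Data.Product.Base using (∃-syntax; _×_; _,_; proj₁; proj₂)
open import Data.Sum.Base as Sum⊎ using (_⊎_; inj₁; inj₂)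
open import Data.Sum.Relation.Binary.Pointwise using (inj₁; inj₂)
open import Data.Unit.Base using (tt)
open import Data.Vec.Functional using (Vector; []; _∷_)
open import Function.Base using (_∘_; id)
open import Function.Bundles using (Inverse; mk⇔)
import Function.Construct.Composition as Composition
open import Function.Properties.Inverse using (Inverse⇒Injection)
open import Level using (0ℓ)
open import Relation.Binary.Bundles using (Setoid)
open import Relation.Binary.Definitions using (Decidable)
import Relation.Binary.Reasoning.Setoid as ≈-Reasoning
open import Relation.Nullary.Decidable using (Dec; yes; no; via-injection)
open import Relation.Nullary.Negation using (¬_)
open import Relation.Unary using (Pred; U; _≐_)
open import Relation.Unary.Properties using (≐-sym; ≐-trans)
open import Defs

-- Finite Heyting fields.

module FieldProperties (F : Field) where

  commutativeRing : CommutativeRing 0ℓ 0ℓ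
  commutativeRing = HeytingCommutativeRing.commutativeRing (HeytingField.heytingCommutativeRing F)

  open CommutativeRing commutativeRing

  1≉0 : ¬ 1# ≈ 0#
  1≉0 1≈0 = proj₂ (HeytingField.tight F 1# 0#) 1≈0
    (ApartnessProperties.1#0 (HeytingField.heytingCommutativeRing F))

  module Finite {n} (size : HasSize (fieldSetoid F) n) where

    infix 4 _≟_

    _≟_ : Decidable _≈_
    _≟_ = via-injection (Inverse⇒Injection size) Fin._≟_

    -- A Heyting field inverts elements apart from 0, while `¬ x ≈ 0#` yields only the double
    -- negation of an apartness. Hence the search through all elements: if it fails, `x` cannot be
    -- apart from 0, and tightness forces `x ≈ 0#`.
    reciprocal : ∀ x → ¬ x ≈ 0# → ∃[ y ] y * x ≈ 1#
    reciprocal x x≉0 with Fin.any? (λ i → Inverse.from size i * x ≟ 1#)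
    ... | yes (i , yx≈1) = Inverse.from size i , yx≈1
    ... | no  ∄y         = ⊥-elim (x≉0 (proj₁ (HeytingField.tight F x 0#) λ x#0 →
      let y , y[x-0]≈1 , _ = HeytingField.#⇒invertible F x#0 in
      ∄y (Inverse.to size y , (begin
        Inverse.from size (Inverse.to size y) * x  ≈⟨ *-congʳ (Inverse.strictlyInverseʳ size y) ⟩
        y * x                                      ≈⟨ *-congˡ (ApartnessProperties.x-0≈x (HeytingField.heytingCommutativeRing F) x) ⟨
        y * (x - 0#)                               ≈⟨ y[x-0]≈1 ⟩
        1#                                         ∎))))
      where open ≈-Reasoning setoid

-- Linear combinations, one-dimensional subspaces and linear automorphisms.

module LinearAlgebra (F : Field) (V : VectorSpace F) where

  open CommutativeRing (FieldProperties.commutativeRing F) hiding (zero)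
  open LeftModule V
  open Sum +ᴹ-monoid using (sum-cong-≋)
  open CommutativeSemigroupProperties (CommutativeMonoid.commutativeSemigroup +ᴹ-commutativeMonoid) public
    using () renaming (interchange to +ᴹ-interchange)
  open ≈-Reasoning ≈ᴹ-setoid

  private
    lc : ∀ {n} → Vector Carrier n → Vector Carrierᴹ n → Carrierᴹ
    lc = linearCombination F V

  lc-congˡ : ∀ {n} (x : Vector Carrier n) {b c} → (∀ i → b i ≈ᴹ c i) → lc x b ≈ᴹ lc x c
  lc-congˡ x b≈c = sum-cong-≋ λ i → *ₗ-congˡ (b≈c i)

  lc-congʳ : ∀ {n} {x y : Vector Carrier n} b → (∀ i → x i ≈ y i) → lc x b ≈ᴹ lc y b
  lc-congʳ b x≈y = sum-cong-≋ λ i → *ₗ-congʳ (x≈y i)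

  lc-+ : ∀ {n} (x y : Vector Carrier n) b → lc (λ i → x i + y i) b ≈ᴹ lc x b +ᴹ lc y b
  lc-+ {zero}  x y b = ≈ᴹ-sym (+ᴹ-identityˡ 0ᴹ)
  lc-+ {suc n} x y b = begin
    (x zero + y zero) *ₗ b zero +ᴹ lc (λ i → x (suc i) + y (suc i)) (b ∘ suc)
      ≈⟨ +ᴹ-cong (*ₗ-distribʳ (b zero) (x zero) (y zero)) (lc-+ (x ∘ suc) (y ∘ suc) (b ∘ suc)) ⟩
    (x zero *ₗ b zero +ᴹ y zero *ₗ b zero) +ᴹ (lc (x ∘ suc) (b ∘ suc) +ᴹ lc (y ∘ suc) (b ∘ suc))
      ≈⟨ +ᴹ-interchange _ _ _ _ ⟩
    lc x b +ᴹ lc y b ∎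

  lc-* : ∀ {n} a (x : Vector Carrier n) b → lc (λ i → a * x i) b ≈ᴹ a *ₗ lc x b
  lc-* {zero}  a x b = ≈ᴹ-sym (*ₗ-zeroʳ a)
  lc-* {suc n} a x b = begin
    (a * x zero) *ₗ b zero +ᴹ lc (λ i → a * x (suc i)) (b ∘ suc)
      ≈⟨ +ᴹ-cong (*ₗ-assoc a (x zero) (b zero)) (lc-* a (x ∘ suc) (b ∘ suc)) ⟩
    a *ₗ (x zero *ₗ b zero) +ᴹ a *ₗ lc (x ∘ suc) (b ∘ suc)
      ≈⟨ *ₗ-distribˡ a _ _ ⟨
    a *ₗ lc x b ∎

  -- Independence is applied to the difference of the coefficients, written `x j + - 1# * y j` so
  -- that `lc-+` and `lc-*` evaluate it.
  independent⇒injective : ∀ {n} {b : Vector Carrierᴹ n} → LinearlyIndependent F V b →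
                          ∀ {x y} → lc x b ≈ᴹ lc y b → ∀ i → x i ≈ y i
  independent⇒injective {b = b} independent {x} {y} xb≈yb i =
    x∙y⁻¹≈ε⇒x≈y (x i) (y i) (trans (+-congˡ (sym (-1*x≈-x (y i)))) (independent _ (begin
      lc (λ j → x j + - 1# * y j) b    ≈⟨ lc-+ x (λ j → - 1# * y j) b ⟩
      lc x b +ᴹ lc (λ j → - 1# * y j) b ≈⟨ +ᴹ-cong (≈ᴹ-trans xb≈yb (≈ᴹ-sym (*ₗ-identityˡ _))) (lc-* (- 1#) y b) ⟩
      1# *ₗ lc y b +ᴹ - 1# *ₗ lc y b    ≈⟨ *ₗ-distribʳ (lc y b) 1# (- 1#) ⟨
      (1# + - 1#) *ₗ lc y b             ≈⟨ *ₗ-congʳ (-‿inverseʳ 1#) ⟩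
      0# *ₗ lc y b                      ≈⟨ *ₗ-zeroˡ (lc y b) ⟩
      0ᴹ                                ∎) i))
    where
    open GroupProperties +-group using (x∙y⁻¹≈ε⇒x≈y)
    open RingProperties ring using (-1*x≈-x)

  module Generator {W : Pred Carrierᴹ 0ℓ} (d : HasDimension F V W 1) where
    open HasDimension d

    generator : Carrierᴹ
    generator = basis zero

    generator∈ : W generator
    generator∈ = basis∈W zero

    generates : ∀ {v} → W v → ∃[ a ] v ≈ᴹ a *ₗ generator
    generates v∈W = let x , v≈xb = spanning v∈W in x zero , ≈ᴹ-trans v≈xb (+ᴹ-identityʳ _)

    generator≉0 : ¬ generator ≈ᴹ 0ᴹ
    generator≉0 g≈0 = FieldProperties.1≉0 F (independent (λ _ → 1#) (begin
      1# *ₗ generator +ᴹ 0ᴹ ≈⟨ +ᴹ-identityʳ _ ⟩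
      1# *ₗ generator       ≈⟨ *ₗ-identityˡ _ ⟩
      generator             ≈⟨ g≈0 ⟩
      0ᴹ                    ∎) zero)

  record IsLinear (g : Carrierᴹ → Carrierᴹ) : Set where
    field
      cong   : ∀ {u v} → u ≈ᴹ v → g u ≈ᴹ g v
      +-homo : ∀ u v → g (u +ᴹ v) ≈ᴹ g u +ᴹ g v
      *-homo : ∀ a v → g (a *ₗ v) ≈ᴹ a *ₗ g v

    0-homo : g 0ᴹ ≈ᴹ 0ᴹ
    0-homo = begin
      g 0ᴹ         ≈⟨ cong (*ₗ-zeroˡ 0ᴹ) ⟨
      g (0# *ₗ 0ᴹ) ≈⟨ *-homo 0# 0ᴹ ⟩
      0# *ₗ g 0ᴹ   ≈⟨ *ₗ-zeroˡ (g 0ᴹ) ⟩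
      0ᴹ           ∎

    lc-homo : ∀ {n} (x : Vector Carrier n) b → g (lc x b) ≈ᴹ lc x (g ∘ b)
    lc-homo {zero}  x b = 0-homo
    lc-homo {suc n} x b = begin
      g (x zero *ₗ b zero +ᴹ lc (x ∘ suc) (b ∘ suc))   ≈⟨ +-homo _ _ ⟩
      g (x zero *ₗ b zero) +ᴹ g (lc (x ∘ suc) (b ∘ suc)) ≈⟨ +ᴹ-cong (*-homo _ _) (lc-homo (x ∘ suc) (b ∘ suc)) ⟩
      lc x (g ∘ b)                                     ∎

  record LinearAutomorphism : Set where
    field
      to          : Carrierᴹ → Carrierᴹ
      from        : Carrierᴹ → Carrierᴹ
      to-linear   : IsLinear to
      from-linear : IsLinear from
      to∘from     : ∀ v → to (from v) ≈ᴹ v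
      from∘to     : ∀ v → from (to v) ≈ᴹ v

    module To = IsLinear to-linear
    module From = IsLinear from-linear

    -- Defined by pulling back along `from`: membership needs no witness, and an inclusion between
    -- two sets is at once an inclusion between their images.
    image : Pred Carrierᴹ 0ℓ → Pred Carrierᴹ 0ℓ
    image W v = W (from v)

    module _ {W : Pred Carrierᴹ 0ℓ} (isSubspace : IsSubspace F V W) where
      open IsSubspace isSubspace

      image-isSubspace : IsSubspace F V (image W)
      image-isSubspace = record
        { resp      = λ u≈v → resp (From.cong u≈v)
        ; 0∈        = resp (≈ᴹ-sym From.0-homo) 0∈
        ; +-closed  = λ u∈W v∈W → resp (≈ᴹ-sym (From.+-homo _ _)) (+-closed u∈W v∈W)
        ; *ₗ-closed = λ a v∈W → resp (≈ᴹ-sym (From.*-homo a _)) (*ₗ-closed a v∈W)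
        }

      image-hasDimension : ∀ {n} → HasDimension F V W n → HasDimension F V (image W) n
      image-hasDimension d = record
        { basis       = to ∘ basis
        ; basis∈W     = λ i → resp (≈ᴹ-sym (from∘to (basis i))) (basis∈W i)
        ; independent = λ x xb≈0 → independent x (begin
            lc x basis               ≈⟨ lc-congˡ x (λ i → from∘to (basis i)) ⟨
            lc x (from ∘ to ∘ basis) ≈⟨ From.lc-homo x (to ∘ basis) ⟨
            from (lc x (to ∘ basis)) ≈⟨ From.cong xb≈0 ⟩
            from 0ᴹ                  ≈⟨ From.0-homo ⟩
            0ᴹ                       ∎)
        ; spanning    = λ {v} v∈W → let x , v≈xb = spanning v∈W in x , (begin
            v                  ≈⟨ to∘from v ⟨
            to (from v)        ≈⟨ To.cong v≈xb ⟩
            to (lc x basis)    ≈⟨ To.lc-homo x basis ⟩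
            lc x (to ∘ basis)  ∎)
        }
        where open HasDimension d

      module _ {W′ : Pred Carrierᴹ 0ℓ} (isSubspace′ : IsSubspace F V W′)
               (d : HasDimension F V W 1) (d′ : HasDimension F V W′ 1) where
        private
          module W = Generator d
          module W′ = Generator d′

        -- Both sides consist of the multiples of one vector, so carrying one subspace to the other
        -- reduces to carrying one generator to the other. This serves over `L` for spread lines and
        -- over `K` for points.
        image-generator : to W.generator ≈ᴹ W′.generator → image W ≐ W′
        image-generator gp≈p′ = image⊆ , ⊆image
          where
          image⊆ : ∀ {v} → image W v → W′ v
          image⊆ {v} v∈ = let a , v≈ap = W.generates v∈ in
            IsSubspace.resp isSubspace′ (begin
              a *ₗ W′.generator    ≈⟨ *ₗ-congˡ gp≈p′ ⟨
              a *ₗ to W.generator  ≈⟨ To.*-homo a _ ⟨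
              to (a *ₗ W.generator) ≈⟨ To.cong v≈ap ⟨
              to (from v)          ≈⟨ to∘from v ⟩
              v                    ∎) (IsSubspace.*ₗ-closed isSubspace′ a W′.generator∈)

          ⊆image : ∀ {v} → W′ v → image W v
          ⊆image {v} v∈ = let a , v≈ap′ = W′.generates v∈ in
            resp (begin
              a *ₗ W.generator             ≈⟨ *ₗ-congˡ (from∘to _) ⟨
              a *ₗ from (to W.generator)   ≈⟨ *ₗ-congˡ (From.cong gp≈p′) ⟩
              a *ₗ from W′.generator       ≈⟨ From.*-homo a _ ⟨
              from (a *ₗ W′.generator)     ≈⟨ From.cong v≈ap′ ⟨
              from v                       ∎) (*ₗ-closed a W.generator∈)

  inverse : LinearAutomorphism → LinearAutomorphism
  inverse g = record
    { to = from ; from = to ; to-linear = from-linear ; from-linear = to-linear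
    ; to∘from = from∘to ; from∘to = to∘from }
    where open LinearAutomorphism g

-- The determinant on a plane over a finite field.

module Plane (L : Field) {n} (size : HasSize (fieldSetoid L) n)
             (V : VectorSpace L) (dimension : HasDimension L V U 2) where

  open CommutativeRing (FieldProperties.commutativeRing L) hiding (zero)
  open FieldProperties L using (1≉0)
  open FieldProperties.Finite L size
  open LeftModule V
  open LinearAlgebra L V
  open HasDimension dimension using (basis; independent; spanning)
  open RingProperties ring using (-‿distribˡ-*; -‿distribʳ-*; -0#≈0#)
  open GroupProperties +-group using () renaming (⁻¹-involutive to -‿involutive)
  open SemiringSolver commutativeSemiring using (solve; _:+_; _:*_; _:=_)
  private
    module ≈ = ≈-Reasoning setoid
    module ≈ᴹ = ≈-Reasoning ≈ᴹ-setoid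

  b₀ b₁ : Carrierᴹ
  b₀ = basis zero
  b₁ = basis (suc zero)

  opaque

    coord : Carrierᴹ → Vector Carrier 2
    coord v = proj₁ (spanning {v} tt)

    coord-expansion : ∀ v → v ≈ᴹ linearCombination L V (coord v) basis
    coord-expansion v = proj₂ (spanning {v} tt)

  -- Independence makes the chosen coordinates canonical, so each coordinate law below needs only a
  -- matching expansion.
  coord-unique : ∀ {v} x → v ≈ᴹ linearCombination L V x basis → ∀ i → coord v i ≈ x i
  coord-unique {v} x v≈xb =
    independent⇒injective {b = basis} independent (≈ᴹ-trans (≈ᴹ-sym (coord-expansion v)) v≈xb)

  coord-cong : ∀ {v w} → v ≈ᴹ w → ∀ i → coord v i ≈ coord w i
  coord-cong {w = w} v≈w = coord-unique (coord w) (≈ᴹ-trans v≈w (coord-expansion w))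

  coord-injective : ∀ {v w} → (∀ i → coord v i ≈ coord w i) → v ≈ᴹ w
  coord-injective {v} {w} v≈w = ≈ᴹ-trans (coord-expansion v)
    (≈ᴹ-trans (lc-congʳ basis v≈w) (≈ᴹ-sym (coord-expansion w)))

  coord-+ : ∀ v w i → coord (v +ᴹ w) i ≈ coord v i + coord w i
  coord-+ v w = coord-unique _ (≈ᴹ-trans (+ᴹ-cong (coord-expansion v) (coord-expansion w))
    (≈ᴹ-sym (lc-+ (coord v) (coord w) basis)))

  coord-* : ∀ a v i → coord (a *ₗ v) i ≈ a * coord v i
  coord-* a v = coord-unique _ (≈ᴹ-trans (*ₗ-congˡ (coord-expansion v))
    (≈ᴹ-sym (lc-* a (coord v) basis)))

  coord-0 : ∀ i → coord 0ᴹ i ≈ 0#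
  coord-0 i = trans (coord-cong (≈ᴹ-sym (*ₗ-zeroˡ 0ᴹ)) i) (trans (coord-* 0# 0ᴹ i) (zeroˡ _))

  basis-expansion : ∀ v → v ≈ᴹ coord v zero *ₗ b₀ +ᴹ coord v (suc zero) *ₗ b₁
  basis-expansion v = ≈ᴹ-trans (coord-expansion v) (+ᴹ-congˡ (+ᴹ-identityʳ _))

  -- The finite field decides whether each coordinate vanishes. The case split in `form-multiple`
  -- rests on this.
  ≈0? : ∀ v → Dec (v ≈ᴹ 0ᴹ)
  ≈0? v with coord v zero ≟ 0# | coord v (suc zero) ≟ 0#
  ... | yes v₀≈0 | yes v₁≈0 = yes (coord-injective λ
    { zero → trans v₀≈0 (sym (coord-0 zero)) ; (suc zero) → trans v₁≈0 (sym (coord-0 (suc zero))) })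
  ... | no v₀≉0 | _ = no λ v≈0 → v₀≉0 (trans (coord-cong v≈0 zero) (coord-0 zero))
  ... | yes _ | no v₁≉0 = no λ v≈0 → v₁≉0 (trans (coord-cong v≈0 (suc zero)) (coord-0 (suc zero)))

  opaque

    -- The sign sits on a single coordinate rather than on a product, so that the semiring solver
    -- can treat the negated coordinate as an atom.
    det : Carrierᴹ → Carrierᴹ → Carrier
    det v w = coord v zero * coord w (suc zero) + - coord v (suc zero) * coord w zero

    det-coord : ∀ v w → det v w ≈ coord v zero * coord w (suc zero) + - coord v (suc zero) * coord w zero
    det-coord v w = refl

  det-cong : ∀ {v v′ w w′} → v ≈ᴹ v′ → w ≈ᴹ w′ → det v w ≈ det v′ w′
  det-cong {v} {v′} {w} {w′} v≈v′ w≈w′ = trans (det-coord v w) (trans (+-cong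
    (*-cong (coord-cong v≈v′ zero) (coord-cong w≈w′ (suc zero)))
    (*-cong (-‿cong (coord-cong v≈v′ (suc zero))) (coord-cong w≈w′ zero))) (sym (det-coord v′ w′)))

  det-congˡ : ∀ {v w w′} → w ≈ᴹ w′ → det v w ≈ det v w′
  det-congˡ = det-cong ≈ᴹ-refl

  det-congʳ : ∀ {v v′ w} → v ≈ᴹ v′ → det v w ≈ det v′ w
  det-congʳ v≈v′ = det-cong v≈v′ ≈ᴹ-refl

  det-self : ∀ v → det v v ≈ 0#
  det-self v = begin
    det v v               ≈⟨ det-coord v v ⟩
    v₀ * v₁ + - v₁ * v₀   ≈⟨ +-congˡ (-‿distribˡ-* v₁ v₀) ⟨
    v₀ * v₁ + - (v₁ * v₀) ≈⟨ +-congˡ (-‿cong (*-comm v₁ v₀)) ⟩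
    v₀ * v₁ + - (v₀ * v₁) ≈⟨ -‿inverseʳ (v₀ * v₁) ⟩
    0#                    ∎
    where
    open ≈
    v₀ = coord v zero
    v₁ = coord v (suc zero)

  det-+ʳ : ∀ u v w → det u (v +ᴹ w) ≈ det u v + det u w
  det-+ʳ u v w = begin
    det u (v +ᴹ w)
      ≈⟨ det-coord u (v +ᴹ w) ⟩
    u₀ * coord (v +ᴹ w) (suc zero) + - u₁ * coord (v +ᴹ w) zero
      ≈⟨ +-cong (*-congˡ (coord-+ v w (suc zero))) (*-congˡ (coord-+ v w zero)) ⟩
    u₀ * (v₁ + w₁) + - u₁ * (v₀ + w₀)
      ≈⟨ solve 6 (λ a b c d e f →
           a :* (b :+ c) :+ d :* (e :+ f) := (a :* b :+ d :* e) :+ (a :* c :+ d :* f))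
           refl u₀ v₁ w₁ (- u₁) v₀ w₀ ⟩
    (u₀ * v₁ + - u₁ * v₀) + (u₀ * w₁ + - u₁ * w₀)
      ≈⟨ +-cong (det-coord u v) (det-coord u w) ⟨
    det u v + det u w ∎
    where
    open ≈
    u₀ = coord u zero
    u₁ = coord u (suc zero)
    v₀ = coord v zero
    v₁ = coord v (suc zero)
    w₀ = coord w zero
    w₁ = coord w (suc zero)

  det-*ʳ : ∀ a v w → det v (a *ₗ w) ≈ a * det v w
  det-*ʳ a v w = begin
    det v (a *ₗ w)
      ≈⟨ det-coord v (a *ₗ w) ⟩
    v₀ * coord (a *ₗ w) (suc zero) + - v₁ * coord (a *ₗ w) zero
      ≈⟨ +-cong (*-congˡ (coord-* a w (suc zero))) (*-congˡ (coord-* a w zero)) ⟩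
    v₀ * (a * w₁) + - v₁ * (a * w₀)
      ≈⟨ solve 5 (λ a b c d e → b :* (a :* c) :+ d :* (a :* e) := a :* (b :* c :+ d :* e))
           refl a v₀ w₁ (- v₁) w₀ ⟩
    a * (v₀ * w₁ + - v₁ * w₀)
      ≈⟨ *-congˡ (det-coord v w) ⟨
    a * det v w ∎
    where
    open ≈
    v₀ = coord v zero
    v₁ = coord v (suc zero)
    w₀ = coord w zero
    w₁ = coord w (suc zero)

  -- The sign is a scalar factor, so linearity in the second argument passes to the first by
  -- distributivity alone.
  det-antisym : ∀ v w → det v w ≈ - 1# * det w v
  det-antisym v w = begin
    det v w                               ≈⟨ det-coord v w ⟩
    v₀ * w₁ + - v₁ * w₀                   ≈⟨ +-cong v₀w₁ -v₁w₀ ⟩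
    - 1# * (- w₁ * v₀) + - 1# * (w₀ * v₁) ≈⟨ +-comm _ _ ⟩
    - 1# * (w₀ * v₁) + - 1# * (- w₁ * v₀) ≈⟨ distribˡ (- 1#) _ _ ⟨
    - 1# * (w₀ * v₁ + - w₁ * v₀)          ≈⟨ *-congˡ (det-coord w v) ⟨
    - 1# * det w v                        ∎
    where
    open ≈
    open RingProperties ring using (-1*x≈-x)
    v₀ = coord v zero
    v₁ = coord v (suc zero)
    w₀ = coord w zero
    w₁ = coord w (suc zero)
    v₀w₁ : v₀ * w₁ ≈ - 1# * (- w₁ * v₀)
    v₀w₁ = begin
      v₀ * w₁             ≈⟨ *-comm v₀ w₁ ⟩
      w₁ * v₀             ≈⟨ -‿involutive _ ⟨
      - - (w₁ * v₀)       ≈⟨ -‿cong (-‿distribˡ-* w₁ v₀) ⟩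
      - (- w₁ * v₀)       ≈⟨ -1*x≈-x _ ⟨
      - 1# * (- w₁ * v₀)  ∎
    -v₁w₀ : - v₁ * w₀ ≈ - 1# * (w₀ * v₁)
    -v₁w₀ = begin
      - v₁ * w₀        ≈⟨ -‿distribˡ-* v₁ w₀ ⟨
      - (v₁ * w₀)      ≈⟨ -‿cong (*-comm v₁ w₀) ⟩
      - (w₀ * v₁)      ≈⟨ -1*x≈-x _ ⟨
      - 1# * (w₀ * v₁) ∎

  det-+ˡ : ∀ u v w → det (u +ᴹ v) w ≈ det u w + det v w
  det-+ˡ u v w = begin
    det (u +ᴹ v) w                  ≈⟨ det-antisym (u +ᴹ v) w ⟩
    - 1# * det w (u +ᴹ v)           ≈⟨ *-congˡ (det-+ʳ w u v) ⟩
    - 1# * (det w u + det w v)      ≈⟨ distribˡ (- 1#) _ _ ⟩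
    - 1# * det w u + - 1# * det w v ≈⟨ +-cong (det-antisym u w) (det-antisym v w) ⟨
    det u w + det v w               ∎
    where open ≈

  det-*ˡ : ∀ a v w → det (a *ₗ v) w ≈ a * det v w
  det-*ˡ a v w = begin
    det (a *ₗ v) w         ≈⟨ det-antisym (a *ₗ v) w ⟩
    - 1# * det w (a *ₗ v)  ≈⟨ *-congˡ (det-*ʳ a w v) ⟩
    - 1# * (a * det w v)   ≈⟨ solve 3 (λ x y z → x :* (y :* z) := y :* (x :* z)) refl _ _ _ ⟩
    a * (- 1# * det w v)   ≈⟨ *-congˡ (det-antisym v w) ⟨
    a * det v w            ∎
    where open ≈

  det-0ˡ : ∀ {v} w → v ≈ᴹ 0ᴹ → det v w ≈ 0#
  det-0ˡ {v} w v≈0 = begin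
    det v w          ≈⟨ det-congʳ (≈ᴹ-trans v≈0 (≈ᴹ-sym (*ₗ-zeroˡ v))) ⟩
    det (0# *ₗ v) w  ≈⟨ det-*ˡ 0# v w ⟩
    0# * det v w     ≈⟨ zeroˡ _ ⟩
    0#               ∎
    where open ≈

  det≈1⇒≉0 : ∀ {v w} → det v w ≈ 1# → ¬ v ≈ᴹ 0ᴹ
  det≈1⇒≉0 {w = w} det≈1 v≈0 = 1≉0 (trans (sym det≈1) (det-0ˡ w v≈0))

  -- The semiring solver treats - x as an atom, hence the cancelling summand.
  cramer₀ : ∀ e₀ e₁ u₀ u₁ w₀ w₁ → (e₀ * u₁ + - e₁ * u₀) * w₀ ≈
            (w₀ * u₁ + - w₁ * u₀) * e₀ + (e₀ * w₁ + - e₁ * w₀) * u₀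
  cramer₀ e₀ e₁ u₀ u₁ w₀ w₁ = begin
    (e₀ * u₁ + - e₁ * u₀) * w₀
      ≈⟨ +-identityʳ _ ⟨
    (e₀ * u₁ + - e₁ * u₀) * w₀ + 0#
      ≈⟨ +-congˡ (trans (*-congʳ (-‿inverseʳ w₁)) (zeroˡ _)) ⟨
    (e₀ * u₁ + - e₁ * u₀) * w₀ + (w₁ + - w₁) * (u₀ * e₀)
      ≈⟨ solve 7 (λ e₀ -e₁ u₀ u₁ w₀ w₁ -w₁ →
           (e₀ :* u₁ :+ -e₁ :* u₀) :* w₀ :+ (w₁ :+ -w₁) :* (u₀ :* e₀)
           := (w₀ :* u₁ :+ -w₁ :* u₀) :* e₀ :+ (e₀ :* w₁ :+ -e₁ :* w₀) :* u₀)
           refl e₀ (- e₁) u₀ u₁ w₀ w₁ (- w₁) ⟩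
    (w₀ * u₁ + - w₁ * u₀) * e₀ + (e₀ * w₁ + - e₁ * w₀) * u₀ ∎
    where open ≈

  cramer₁ : ∀ e₀ e₁ u₀ u₁ w₀ w₁ → (e₀ * u₁ + - e₁ * u₀) * w₁ ≈
            (w₀ * u₁ + - w₁ * u₀) * e₁ + (e₀ * w₁ + - e₁ * w₀) * u₁
  cramer₁ e₀ e₁ u₀ u₁ w₀ w₁ = begin
    (e₀ * u₁ + - e₁ * u₀) * w₁
      ≈⟨ +-identityʳ _ ⟨
    (e₀ * u₁ + - e₁ * u₀) * w₁ + 0#
      ≈⟨ +-congˡ (trans (*-congʳ (-‿inverseʳ e₁)) (zeroˡ _)) ⟨
    (e₀ * u₁ + - e₁ * u₀) * w₁ + (e₁ + - e₁) * (w₀ * u₁)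
      ≈⟨ solve 7 (λ e₀ e₁ -e₁ u₀ u₁ w₀ w₁ →
           (e₀ :* u₁ :+ -e₁ :* u₀) :* w₁ :+ (e₁ :+ -e₁) :* (w₀ :* u₁)
           := (w₀ :* u₁ :* e₁ :+ (-e₁ :* w₁) :* u₀) :+ (e₀ :* w₁ :+ -e₁ :* w₀) :* u₁)
           refl e₀ e₁ (- e₁) u₀ u₁ w₀ w₁ ⟩
    (w₀ * u₁ * e₁ + (- e₁ * w₁) * u₀) + (e₀ * w₁ + - e₁ * w₀) * u₁
      -- To the solver `- e₁` and `- w₁` are unrelated atoms, so the sign is moved from one factor
      -- to the other by hand.
      ≈⟨ +-congʳ (+-congˡ (*-congʳ -e₁w₁≈-w₁e₁)) ⟩
    (w₀ * u₁ * e₁ + (- w₁ * e₁) * u₀) + (e₀ * w₁ + - e₁ * w₀) * u₁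
      ≈⟨ +-congʳ (solve 5 (λ w₀ u₁ e₁ -w₁ u₀ →
           w₀ :* u₁ :* e₁ :+ (-w₁ :* e₁) :* u₀ := (w₀ :* u₁ :+ -w₁ :* u₀) :* e₁)
           refl w₀ u₁ e₁ (- w₁) u₀) ⟩
    (w₀ * u₁ + - w₁ * u₀) * e₁ + (e₀ * w₁ + - e₁ * w₀) * u₁ ∎
    where
    open ≈
    -e₁w₁≈-w₁e₁ : - e₁ * w₁ ≈ - w₁ * e₁
    -e₁w₁≈-w₁e₁ = begin
      - e₁ * w₁   ≈⟨ -‿distribˡ-* e₁ w₁ ⟨
      - (e₁ * w₁) ≈⟨ -‿distribʳ-* e₁ w₁ ⟩
      e₁ * - w₁   ≈⟨ *-comm e₁ (- w₁) ⟩
      - w₁ * e₁   ∎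

  -- Cramer's rule, free of division: three vectors in a plane satisfy a linear relation whose
  -- coefficients are their pairwise determinants.
  cramer : ∀ e u w i → det e u * coord w i ≈ det w u * coord e i + det e w * coord u i
  cramer e u w i = trans (*-congʳ (det-coord e u)) (trans (cramer-coord i)
    (sym (+-cong (*-congʳ (det-coord w u)) (*-congʳ (det-coord e w)))))
    where
    cramer-coord : ∀ i →
      (coord e zero * coord u (suc zero) + - coord e (suc zero) * coord u zero) * coord w i ≈
      (coord w zero * coord u (suc zero) + - coord w (suc zero) * coord u zero) * coord e i +
      (coord e zero * coord w (suc zero) + - coord e (suc zero) * coord w zero) * coord u i
    cramer-coord zero       = cramer₀ _ _ _ _ _ _
    cramer-coord (suc zero) = cramer₁ _ _ _ _ _ _

  -- By Cramer's rule with leading coefficient 1, the functionals `det _ u` and `det e _` form the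
  -- basis dual to `(e , u)`.
  det-expansion : ∀ {e u} → det e u ≈ 1# → ∀ w → w ≈ᴹ det w u *ₗ e +ᴹ det e w *ₗ u
  det-expansion {e} {u} det≈1 w = coord-injective λ i → begin
    coord w i                                         ≈⟨ *-identityˡ _ ⟨
    1# * coord w i                                    ≈⟨ *-congʳ det≈1 ⟨
    det e u * coord w i                               ≈⟨ cramer e u w i ⟩
    det w u * coord e i + det e w * coord u i         ≈⟨ +-cong (coord-* _ e i) (coord-* _ u i) ⟨
    coord (det w u *ₗ e) i + coord (det e w *ₗ u) i   ≈⟨ coord-+ _ _ i ⟨
    coord (det w u *ₗ e +ᴹ det e w *ₗ u) i            ∎
    where open ≈

  -- One of the two factors `coord e zero` and `- coord e (suc zero)` in the determinant is
  -- invertible. Its reciprocal, placed on the other basis vector (`b₁` or `b₀` respectively), gives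
  -- `u`.
  det-completion : ∀ e → ¬ e ≈ᴹ 0ᴹ → ∃[ u ] det e u ≈ 1#
  det-completion e e≉0 with coord e zero ≟ 0# | - coord e (suc zero) ≟ 0#
  ... | no e₀≉0 | _ =
    let y , ye₀≈1 = reciprocal _ e₀≉0
        x = 0# ∷ y ∷ []
    in linearCombination L V x basis , (begin
      det e (linearCombination L V x basis)
        ≈⟨ det-coord e _ ⟩
      coord e zero * coord (linearCombination L V x basis) (suc zero) +
      - coord e (suc zero) * coord (linearCombination L V x basis) zero
        ≈⟨ +-cong (*-congˡ (coord-unique x ≈ᴹ-refl (suc zero))) (*-congˡ (coord-unique x ≈ᴹ-refl zero)) ⟩
      coord e zero * y + - coord e (suc zero) * 0#  ≈⟨ +-cong (trans (*-comm _ y) ye₀≈1) (zeroʳ _) ⟩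
      1# + 0#                                       ≈⟨ +-identityʳ 1# ⟩
      1#                                            ∎)
    where open ≈
  ... | yes _ | no -e₁≉0 =
    let y , y[-e₁]≈1 = reciprocal _ -e₁≉0
        x = y ∷ 0# ∷ []
    in linearCombination L V x basis , (begin
      det e (linearCombination L V x basis)
        ≈⟨ det-coord e _ ⟩
      coord e zero * coord (linearCombination L V x basis) (suc zero) +
      - coord e (suc zero) * coord (linearCombination L V x basis) zero
        ≈⟨ +-cong (*-congˡ (coord-unique x ≈ᴹ-refl (suc zero))) (*-congˡ (coord-unique x ≈ᴹ-refl zero)) ⟩
      coord e zero * 0# + - coord e (suc zero) * y  ≈⟨ +-cong (zeroʳ _) (trans (*-comm _ y) y[-e₁]≈1) ⟩
      0# + 1#                                       ≈⟨ +-identityˡ 1# ⟩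
      1#                                            ∎)
    where open ≈
  ... | yes e₀≈0 | yes -e₁≈0 = ⊥-elim (e≉0 (coord-injective λ
    { zero → trans e₀≈0 (sym (coord-0 zero))
    ; (suc zero) → trans (sym (-‿involutive _)) (trans (-‿cong -e₁≈0) (trans -0#≈0# (sym (coord-0 (suc zero)))))
    }))

  module _ {e u} (det≈1 : det e u ≈ 1#) where

    det-combinationʳ : ∀ a b → det e (a *ₗ e +ᴹ b *ₗ u) ≈ b
    det-combinationʳ a b = begin
      det e (a *ₗ e +ᴹ b *ₗ u)        ≈⟨ det-+ʳ e _ _ ⟩
      det e (a *ₗ e) + det e (b *ₗ u) ≈⟨ +-cong (det-*ʳ a e e) (det-*ʳ b e u) ⟩
      a * det e e + b * det e u       ≈⟨ +-cong (*-congˡ (det-self e)) (*-congˡ det≈1) ⟩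
      a * 0# + b * 1#                 ≈⟨ +-cong (zeroʳ a) (*-identityʳ b) ⟩
      0# + b                          ≈⟨ +-identityˡ b ⟩
      b                               ∎
      where open ≈

    det-combinationˡ : ∀ a b → det (a *ₗ e +ᴹ b *ₗ u) u ≈ a
    det-combinationˡ a b = begin
      det (a *ₗ e +ᴹ b *ₗ u) u        ≈⟨ det-+ˡ _ _ u ⟩
      det (a *ₗ e) u + det (b *ₗ u) u ≈⟨ +-cong (det-*ˡ a e u) (det-*ˡ b u u) ⟩
      a * det e u + b * det u u       ≈⟨ +-cong (*-congˡ det≈1) (*-congˡ (det-self u)) ⟩
      a * 1# + b * 0#                 ≈⟨ +-cong (*-identityʳ a) (zeroʳ b) ⟩
      a + 0#                          ≈⟨ +-identityʳ a ⟩
      a                               ∎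
      where open ≈

    -- Every basis of determinant 1 gives the same formula `ad - bc`. Both `map-det` and
    -- `affine-injective` follow from this.
    det-combination : ∀ a b c d → det (a *ₗ e +ᴹ b *ₗ u) (c *ₗ e +ᴹ d *ₗ u) ≈ a * d + b * (- 1# * c)
    det-combination a b c d = begin
      det (a *ₗ e +ᴹ b *ₗ u) w            ≈⟨ det-+ˡ _ _ w ⟩
      det (a *ₗ e) w + det (b *ₗ u) w     ≈⟨ +-cong (det-*ˡ a e w) (det-*ˡ b u w) ⟩
      a * det e w + b * det u w           ≈⟨ +-congˡ (*-congˡ (det-antisym u w)) ⟩
      a * det e w + b * (- 1# * det w u)  ≈⟨ +-cong (*-congˡ (det-combinationʳ c d)) (*-congˡ (*-congˡ (det-combinationˡ c d))) ⟩
      a * d + b * (- 1# * c)              ∎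
      where
      open ≈
      w = c *ₗ e +ᴹ d *ₗ u

  -- For p ≉ 0 this is the line L p.
  polar : Carrierᴹ → Pred Carrierᴹ 0ℓ
  polar p w = det p w ≈ 0#

  polar-isSubspace : ∀ p → IsSubspace L V (polar p)
  polar-isSubspace p = record
    { resp      = λ v≈w → trans (det-congˡ (≈ᴹ-sym v≈w))
    ; 0∈        = trans (det-congˡ (≈ᴹ-sym (*ₗ-zeroˡ 0ᴹ))) (trans (det-*ʳ 0# p 0ᴹ) (zeroˡ _))
    ; +-closed  = λ v∈ w∈ → trans (det-+ʳ p _ _) (trans (+-cong v∈ w∈) (+-identityˡ 0#))
    ; *ₗ-closed = λ a v∈ → trans (det-*ʳ a p _) (trans (*-congˡ v∈) (zeroʳ a))
    }

  module _ {p} (p≉0 : ¬ p ≈ᴹ 0ᴹ) where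

    -- Once `p` is completed to a basis of determinant 1, the second coefficient of `w` is
    -- `det p w`, which vanishes.
    polar-generates : ∀ {w} → polar p w → ∃[ a ] w ≈ᴹ a *ₗ p
    polar-generates {w} w∈ =
      let u , det≈1 = det-completion p p≉0 in det w u , (begin
      w                            ≈⟨ det-expansion det≈1 w ⟩
      det w u *ₗ p +ᴹ det p w *ₗ u ≈⟨ +ᴹ-congˡ (≈ᴹ-trans (*ₗ-congʳ w∈) (*ₗ-zeroˡ u)) ⟩
      det w u *ₗ p +ᴹ 0ᴹ           ≈⟨ +ᴹ-identityʳ _ ⟩
      det w u *ₗ p                 ∎)
      where open ≈ᴹ

    polar-hasDimension : HasDimension L V (polar p) 1
    polar-hasDimension = record
      { basis       = λ _ → p
      ; basis∈W     = λ _ → det-self p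
      ; independent = λ { x xp≈0 zero →
          let u , det≈1 = det-completion p p≉0 in begin
          x zero                    ≈⟨ *-identityʳ _ ⟨
          x zero * 1#               ≈⟨ *-congˡ det≈1 ⟨
          x zero * det p u          ≈⟨ det-*ˡ _ p u ⟨
          det (x zero *ₗ p) u       ≈⟨ det-0ˡ u (≈ᴹ-trans (≈ᴹ-sym (+ᴹ-identityʳ _)) xp≈0) ⟩
          0#                        ∎ }
      ; spanning    = λ w∈ → let a , w≈ap = polar-generates w∈ in
          (λ _ → a) , ≈ᴹ-trans w≈ap (≈ᴹ-sym (+ᴹ-identityʳ _))
      }
      where open ≈

  module _ {W : Pred Carrierᴹ 0ℓ} (d : HasDimension L V W 1) where
    open Generator d

    det-degenerate : ∀ {v w} → W v → W w → det v w ≈ 0#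
    det-degenerate {v} {w} v∈ w∈ =
      let a , v≈ag = generates v∈
          b , w≈bg = generates w∈
      in begin
      det v w                               ≈⟨ det-cong v≈ag w≈bg ⟩
      det (a *ₗ generator) (b *ₗ generator) ≈⟨ det-*ˡ a _ _ ⟩
      a * det generator (b *ₗ generator)    ≈⟨ *-congˡ (det-*ʳ b _ _) ⟩
      a * (b * det generator generator)     ≈⟨ *-congˡ (*-congˡ (det-self generator)) ⟩
      a * (b * 0#)                          ≈⟨ *-congˡ (zeroʳ b) ⟩
      a * 0#                                ≈⟨ zeroʳ a ⟩
      0#                                    ∎
      where open ≈

  polar-cong : ∀ {p p′} → p ≈ᴹ p′ → polar p ≐ polar p′
  polar-cong p≈p′ = trans (det-congʳ (≈ᴹ-sym p≈p′)) , trans (det-congʳ p≈p′)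

  -- Linear maps of determinant 1 and the directions they move.

  module ChangeOfBasis {e u e′ u′} (det≈1 : det e u ≈ 1#) (det′≈1 : det e′ u′ ≈ 1#) where

    -- The coefficients are the coordinates of `v` in `(e , u)`, by `det-expansion`; this is
    -- therefore the linear map with `e ↦ e′` and `u ↦ u′`.
    map : Carrierᴹ → Carrierᴹ
    map v = det v u *ₗ e′ +ᴹ det e v *ₗ u′

    map-linear : IsLinear map
    map-linear = record
      { cong   = λ v≈w → +ᴹ-cong (*ₗ-congʳ (det-congʳ v≈w)) (*ₗ-congʳ (det-congˡ v≈w))
      ; +-homo = λ v w → begin
          map (v +ᴹ w)
            ≈⟨ +ᴹ-cong (*ₗ-congʳ (det-+ˡ v w u)) (*ₗ-congʳ (det-+ʳ e v w)) ⟩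
          (det v u + det w u) *ₗ e′ +ᴹ (det e v + det e w) *ₗ u′
            ≈⟨ +ᴹ-cong (*ₗ-distribʳ e′ _ _) (*ₗ-distribʳ u′ _ _) ⟩
          (det v u *ₗ e′ +ᴹ det w u *ₗ e′) +ᴹ (det e v *ₗ u′ +ᴹ det e w *ₗ u′)
            ≈⟨ +ᴹ-interchange _ _ _ _ ⟩
          map v +ᴹ map w ∎
      ; *-homo = λ a v → begin
          map (a *ₗ v)
            ≈⟨ +ᴹ-cong (*ₗ-congʳ (det-*ˡ a v u)) (*ₗ-congʳ (det-*ʳ a e v)) ⟩
          (a * det v u) *ₗ e′ +ᴹ (a * det e v) *ₗ u′
            ≈⟨ +ᴹ-cong (*ₗ-assoc a _ e′) (*ₗ-assoc a _ u′) ⟩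
          a *ₗ (det v u *ₗ e′) +ᴹ a *ₗ (det e v *ₗ u′)
            ≈⟨ *ₗ-distribˡ a _ _ ⟨
          a *ₗ map v ∎
      }
      where open ≈ᴹ

    map-e : map e ≈ᴹ e′
    map-e = begin
      det e u *ₗ e′ +ᴹ det e e *ₗ u′ ≈⟨ +ᴹ-cong (*ₗ-congʳ det≈1) (*ₗ-congʳ (det-self e)) ⟩
      1# *ₗ e′ +ᴹ 0# *ₗ u′           ≈⟨ +ᴹ-cong (*ₗ-identityˡ e′) (*ₗ-zeroˡ u′) ⟩
      e′ +ᴹ 0ᴹ                       ≈⟨ +ᴹ-identityʳ e′ ⟩
      e′                             ∎
      where open ≈ᴹ

    map-u : map u ≈ᴹ u′
    map-u = begin
      det u u *ₗ e′ +ᴹ det e u *ₗ u′ ≈⟨ +ᴹ-cong (*ₗ-congʳ (det-self u)) (*ₗ-congʳ det≈1) ⟩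
      0# *ₗ e′ +ᴹ 1# *ₗ u′           ≈⟨ +ᴹ-cong (*ₗ-zeroˡ e′) (*ₗ-identityˡ u′) ⟩
      0ᴹ +ᴹ u′                       ≈⟨ +ᴹ-identityˡ u′ ⟩
      u′                             ∎
      where open ≈ᴹ

    -- The coefficients of `map v` in `(e′ , u′)` are those of `v` in `(e , u)`, and
    -- `det-combination` gives the same value in both bases.
    map-det : ∀ v w → det (map v) (map w) ≈ det v w
    map-det v w = begin
      det (map v) (map w)
        ≈⟨ det-combination det′≈1 _ _ _ _ ⟩
      det v u * det e w + det e v * (- 1# * det w u)
        ≈⟨ det-combination det≈1 _ _ _ _ ⟨
      det (det v u *ₗ e +ᴹ det e v *ₗ u) (det w u *ₗ e +ᴹ det e w *ₗ u)
        ≈⟨ det-cong (det-expansion det≈1 v) (det-expansion det≈1 w) ⟨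
      det v w ∎
      where open ≈

  map-inverse : ∀ {e u e′ u′} (det≈1 : det e u ≈ 1#) (det′≈1 : det e′ u′ ≈ 1#) v →
                ChangeOfBasis.map det′≈1 det≈1 (ChangeOfBasis.map det≈1 det′≈1 v) ≈ᴹ v
  map-inverse {e} {u} {e′} {u′} det≈1 det′≈1 v = begin
    det (map v) u′ *ₗ e +ᴹ det e′ (map v) *ₗ u
      ≈⟨ +ᴹ-cong (*ₗ-congʳ (det-combinationˡ det′≈1 _ _)) (*ₗ-congʳ (det-combinationʳ det′≈1 _ _)) ⟩
    det v u *ₗ e +ᴹ det e v *ₗ u
      ≈⟨ det-expansion det≈1 v ⟨
    v ∎
    where
    open ≈ᴹ
    open ChangeOfBasis det≈1 det′≈1

  changeOfBasis : ∀ {e u e′ u′} → det e u ≈ 1# → det e′ u′ ≈ 1# → LinearAutomorphism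
  changeOfBasis det≈1 det′≈1 = record
    { to          = ChangeOfBasis.map det≈1 det′≈1
    ; from        = ChangeOfBasis.map det′≈1 det≈1
    ; to-linear   = ChangeOfBasis.map-linear det≈1 det′≈1
    ; from-linear = ChangeOfBasis.map-linear det′≈1 det≈1
    ; to∘from     = map-inverse det′≈1 det≈1
    ; from∘to     = map-inverse det≈1 det′≈1
    }

  record Direction (W : Pred Carrierᴹ 0ℓ) : Set where
    field
      isSubspace   : IsSubspace L V W
      hasDimension : HasDimension L V W 1
    open IsSubspace isSubspace public
    open Generator hasDimension public

    -- A nonzero vector determines the direction through it, so two directions are shown equal by
    -- exhibiting a common nonzero vector.
    ≐polar : ∀ {p} → ¬ p ≈ᴹ 0ᴹ → W p → W ≐ polar p
    ≐polar p≉0 p∈ = det-degenerate hasDimension p∈ , λ w∈ →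
      let a , w≈ap = polar-generates p≉0 w∈ in resp (≈ᴹ-sym w≈ap) (*ₗ-closed a p∈)

  polar-direction : ∀ {p} → ¬ p ≈ᴹ 0ᴹ → Direction (polar p)
  polar-direction {p} p≉0 = record
    { isSubspace = polar-isSubspace p ; hasDimension = polar-hasDimension p≉0 }

  image-direction : ∀ g {W} → Direction W → Direction (LinearAutomorphism.image g W)
  image-direction g W-direction = record
    { isSubspace   = LinearAutomorphism.image-isSubspace g isSubspace
    ; hasDimension = LinearAutomorphism.image-hasDimension g isSubspace hasDimension
    }
    where open Direction W-direction

  -- What a stabiliser element requires: `det-preserved` makes it an isometry, `image-fixed` keeps
  -- the removed line in place, and `moves` yields transitivity.
  record Transport (W : Pred Carrierᴹ 0ℓ) (p p′ : Carrierᴹ) : Set where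
    field
      automorphism  : LinearAutomorphism
    open LinearAutomorphism automorphism public
    field
      det-preserved : ∀ v w → det (to v) (to w) ≈ det v w
      image-fixed   : image W ≐ W
      moves         : to p ≈ᴹ p′

  -- Directions distinct from a fixed one.

  module Removed {W : Pred Carrierᴹ 0ℓ} (W-direction : Direction W) where
    private
      module W = Direction W-direction

    e : Carrierᴹ
    e = W.generator

    -- Not lying in `W`, phrased by the determinant so that `reciprocal` applies to it directly.
    Off : Carrierᴹ → Set
    Off p = ¬ det e p ≈ 0#

    -- A vanishing determinant would put `p` in `W`; then `W` and `W′` would share a nonzero vector
    -- and coincide.
    off : ∀ {W′ p} → Direction W′ → ¬ W′ ≐ W → W′ p → ¬ p ≈ᴹ 0ᴹ → Off p
    off W′-direction W′≉W p∈W′ p≉0 det≈0 = W′≉W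
      (≐-trans (Direction.≐polar W′-direction p≉0 p∈W′) (≐-sym (W.≐polar p≉0 p∈W)))
      where p∈W = proj₂ (W.≐polar W.generator≉0 W.generator∈) det≈0

    complement : ∀ {p} → Off p → ∃[ e′ ] (W e′ × det e′ p ≈ 1#)
    complement {p} p-off = let y , yd≈1 = reciprocal _ p-off in
      y *ₗ e , W.*ₗ-closed y W.generator∈ , trans (det-*ˡ y e p) yd≈1

    -- The map sends `e₁` to `e₂`, so the nonzero vector `e₂` lies both in the image of `W` and in
    -- `W`; each of them is therefore `polar e₂`.
    changeOfBasis-fixes : ∀ {e₁ p₁ e₂ p₂} (det₁≈1 : det e₁ p₁ ≈ 1#) (det₂≈1 : det e₂ p₂ ≈ 1#) →
                          W e₁ → W e₂ →
                          LinearAutomorphism.image (changeOfBasis det₁≈1 det₂≈1) W ≐ W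
    changeOfBasis-fixes {e₁} {p₁} {e₂} {p₂} det₁≈1 det₂≈1 e₁∈W e₂∈W = ≐-trans
      (Direction.≐polar (image-direction (changeOfBasis det₁≈1 det₂≈1) W-direction) e₂≉0
        (W.resp (≈ᴹ-sym (ChangeOfBasis.map-e det₂≈1 det₁≈1)) e₁∈W))
      (≐-sym (W.≐polar e₂≉0 e₂∈W))
      where
      e₂≉0 : ¬ e₂ ≈ᴹ 0ᴹ
      e₂≉0 = det≈1⇒≉0 det₂≈1

    changeOfBasis-transport : ∀ {e₁ p₁ e₂ p₂} → det e₁ p₁ ≈ 1# → det e₂ p₂ ≈ 1# →
                              W e₁ → W e₂ → Transport W p₁ p₂
    changeOfBasis-transport det₁≈1 det₂≈1 e₁∈W e₂∈W = record
      { automorphism  = changeOfBasis det₁≈1 det₂≈1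
      ; det-preserved = ChangeOfBasis.map-det det₁≈1 det₂≈1
      ; image-fixed   = changeOfBasis-fixes det₁≈1 det₂≈1 e₁∈W e₂∈W
      ; moves         = ChangeOfBasis.map-u det₁≈1 det₂≈1
      }

    transport : ∀ {p p′} → Off p → Off p′ → Transport W p p′
    transport p-off p′-off = changeOfBasis-transport
      (proj₂ (proj₂ (complement p-off))) (proj₂ (proj₂ (complement p′-off)))
      (proj₁ (proj₂ (complement p-off))) (proj₁ (proj₂ (complement p′-off)))

    private
      completion = det-completion e W.generator≉0

      e⊥ : Carrierᴹ
      e⊥ = proj₁ completion

      det-e-e⊥ : det e e⊥ ≈ 1#
      det-e-e⊥ = proj₂ completion

    -- Every direction other than W = L e meets the affine line e⊥ + L e exactly once.
    affine : Carrier → Carrierᴹ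
    affine a = a *ₗ e +ᴹ 1# *ₗ e⊥

    affine-cong : ∀ {a b} → a ≈ b → affine a ≈ᴹ affine b
    affine-cong a≈b = +ᴹ-congʳ (*ₗ-congʳ a≈b)

    det-e-affine : ∀ a → det e (affine a) ≈ 1#
    det-e-affine a = det-combinationʳ det-e-e⊥ a 1#

    affine∉W : ∀ a → ¬ W (affine a)
    affine∉W a a∈W = 1≉0 (trans (sym (det-e-affine a)) (det-degenerate W.hasDimension W.generator∈ a∈W))

    affine≉0 : ∀ a → ¬ affine a ≈ᴹ 0ᴹ
    affine≉0 a a≈0 = affine∉W a (W.resp (≈ᴹ-sym a≈0) W.0∈)

    -- The determinant of `affine a` and `affine b` is `a - b`, and it vanishes on a one-dimensional
    -- subspace.
    affine-injective : ∀ {W′ a b} → Direction W′ → W′ (affine a) → W′ (affine b) → a ≈ b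
    affine-injective {a = a} {b} W′-direction a∈ b∈ = x∙y⁻¹≈ε⇒x≈y a b (begin
      a - b                        ≈⟨ +-cong (*-identityʳ a) (-1*x≈-x b) ⟨
      a * 1# + - 1# * b            ≈⟨ +-congˡ (*-identityˡ _) ⟨
      a * 1# + 1# * (- 1# * b)     ≈⟨ det-combination det-e-e⊥ a 1# b 1# ⟨
      det (affine a) (affine b)    ≈⟨ det-degenerate (Direction.hasDimension W′-direction) a∈ b∈ ⟩
      0#                           ∎)
      where
      open ≈
      open GroupProperties +-group using (x∙y⁻¹≈ε⇒x≈y)
      open RingProperties ring using (-1*x≈-x)

    -- Rescaling the generator of `W′` gives a vector `v` with `det e v ≈ 1#`. Its expansion in
    -- `(e , e⊥)` is then `affine a` with `a = det v e⊥`.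
    affine-meets : ∀ {W′} → Direction W′ → ¬ W′ ≐ W → ∃[ a ] W′ (affine a)
    affine-meets W′-direction W′≉W =
      let y , yd≈1 = reciprocal _ (off W′-direction W′≉W generator∈ generator≉0)
          v = y *ₗ generator
      in det v e⊥ , resp
        (≈ᴹ-trans (det-expansion det-e-e⊥ v)
          (+ᴹ-congˡ (*ₗ-congʳ (trans (det-*ʳ y e generator) yd≈1))))
        (*ₗ-closed y generator∈)
      where open Direction W′-direction

-- Symplectic isometries as automorphisms of the incidence graph.

module Isometries (K : Field) (f : SymplecticForm K (coordinateSpace K 4)) where

  open W₃ K f
  open Graph incidenceGraph using (_~_)
  open LinearAlgebra K (coordinateSpace K 4)
  open LeftModule (coordinateSpace K 4)
  open SymplecticForm f
  open CommutativeRing (FieldProperties.commutativeRing K) using (_≈_; sym; trans)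
  open LeftModuleMorphisms.IsLeftModuleHomomorphism using (⟦⟧-cong)

  form-cong : ∀ {u u′ v v′} → u ≈ᴹ u′ → v ≈ᴹ v′ → form u v ≈ form u′ v′
  form-cong u≈u′ v≈v′ = trans (⟦⟧-cong (linearˡ _) u≈u′) (⟦⟧-cong (linearʳ _) v≈v′)

  record Isometry : Set where
    field
      automorphism : LinearAutomorphism
    open LinearAutomorphism automorphism public
    field
      isometric : ∀ u v → form (to u) (to v) ≈ form u v

    mapPoint : Point → Point
    mapPoint P = record
      { carrier    = image carrier
      ; isSubspace = image-isSubspace isSubspace
      ; dimension  = image-hasDimension isSubspace dimension
      }
      where open Point P

    mapLine : Line → Line
    mapLine l = record
      { carrier    = image carrier
      ; isSubspace = image-isSubspace isSubspace
      ; dimension  = image-hasDimension isSubspace dimension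
      ; isotropic  = λ {u} {v} u∈ v∈ →
          trans (form-cong (≈ᴹ-sym (to∘from u)) (≈ᴹ-sym (to∘from v)))
                (trans (isometric (from u) (from v)) (isotropic u∈ v∈))
      }
      where open Line l

    mapVertex : Point ⊎ Line → Point ⊎ Line
    mapVertex = Sum⊎.map mapPoint mapLine

    mapVertex-cong : ∀ {x y} → Graph._≈_ incidenceGraph x y →
                     Graph._≈_ incidenceGraph (mapVertex x) (mapVertex y)
    mapVertex-cong (inj₁ (P⊆Q , Q⊆P)) = inj₁ ((λ v∈ → P⊆Q v∈) , λ v∈ → Q⊆P v∈)
    mapVertex-cong (inj₂ (l⊆m , m⊆l)) = inj₂ ((λ v∈ → l⊆m v∈) , λ v∈ → m⊆l v∈)

  infix 30 _⁻¹
  _⁻¹ : Isometry → Isometry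
  g ⁻¹ = record
    { automorphism = inverse automorphism
    ; isometric    = λ u v → trans (sym (isometric (from u) (from v)))
                                   (form-cong (to∘from u) (to∘from v))
    }
    where open Isometry g

  open Isometry using (mapPoint; mapLine; mapVertex; mapVertex-cong)

  -- The composite pulls a subspace back along `from h` followed by `from g`. Keeping `g` and `h`
  -- separate covers both orders of composing an isometry with its inverse.
  mapVertex-cancel : ∀ g h → (∀ v → Isometry.from g (Isometry.from h v) ≈ᴹ v) →
                     ∀ x → Graph._≈_ incidenceGraph (mapVertex h (mapVertex g x)) x
  mapVertex-cancel g h cancel (inj₁ P) = inj₁
    ((λ v∈ → resp (cancel _) v∈) , λ v∈ → resp (≈ᴹ-sym (cancel _)) v∈)
    where open IsSubspace (Point.isSubspace P)
  mapVertex-cancel g h cancel (inj₂ l) = inj₂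
    ((λ v∈ → resp (cancel _) v∈) , λ v∈ → resp (≈ᴹ-sym (cancel _)) v∈)
    where open IsSubspace (Line.isSubspace l)

  mapVertex-adjacent : ∀ g x y → x ~ y → mapVertex g x ~ mapVertex g y
  mapVertex-adjacent g (inj₁ P) (inj₂ l) P⊆l = λ v∈ → P⊆l v∈
  mapVertex-adjacent g (inj₂ l) (inj₁ P) P⊆l = λ v∈ → P⊆l v∈
  mapVertex-adjacent g (inj₁ _) (inj₁ _) ()
  mapVertex-adjacent g (inj₂ _) (inj₂ _) ()

  graphAutomorphism : Isometry → Automorphism incidenceGraph
  graphAutomorphism g = record
    { permutation = record
      { to        = mapVertex g
      ; from      = mapVertex (g ⁻¹)
      ; to-cong   = mapVertex-cong g
      ; from-cong = mapVertex-cong (g ⁻¹)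
      ; inverse   =
          (λ {x} {y} y≈ → trans′ (mapVertex-cong g y≈) (gg⁻¹ x)) ,
          (λ {x} {y} y≈ → trans′ (mapVertex-cong (g ⁻¹) y≈) (g⁻¹g x))
      }
    ; adjacency = λ x y → mk⇔ (mapVertex-adjacent g x y) λ gx~gy →
        respects (g⁻¹g x) (g⁻¹g y)
          (mapVertex-adjacent (g ⁻¹) (mapVertex g x) (mapVertex g y) gx~gy)
    }
    where
    open Graph incidenceGraph using (vertices; ~-respʳ; ~-sym)
    open Setoid vertices using () renaming (_≈_ to _≈ᵛ_; trans to trans′)
    g⁻¹g : ∀ x → mapVertex (g ⁻¹) (mapVertex g x) ≈ᵛ x
    g⁻¹g = mapVertex-cancel g (g ⁻¹) (Isometry.from∘to g)
    gg⁻¹ : ∀ x → mapVertex g (mapVertex (g ⁻¹) x) ≈ᵛ x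
    gg⁻¹ = mapVertex-cancel (g ⁻¹) g (Isometry.to∘from g)
    respects : ∀ {x x′ y y′} → x ≈ᵛ x′ → y ≈ᵛ y′ → x ~ y → x′ ~ y′
    respects {x} {x′} {y} {y′} x≈x′ y≈y′ x~y =
      ~-sym {y′} {x′} (~-respʳ {y′} {x} {x′} x≈x′ (~-sym {x} {y′} (~-respʳ {x} {y} {y′} y≈y′ x~y)))

-- The symplectic form expressed by the determinant over `L`.

module RegularSpread (K : Field) (f : SymplecticForm K (coordinateSpace K 4)) (q : ℕ)
                     (S : W₃.LineSet K f) (regular : W₃.IsRegular K f q S) where

  open W₃ K f
  open Isometries K f
  open SymplecticForm f

  R : FieldReduction K (coordinateSpace K 4) q
  R = proj₁ regular

  open FieldReduction R using (L; L-size; reduced; ι; extends)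

  open CommutativeRing (FieldProperties.commutativeRing K) hiding (zero)
  private
    module L = CommutativeRing (FieldProperties.commutativeRing L)
    module KV = LinearAlgebra K (coordinateSpace K 4)

  open LeftModule reduced
  open LinearAlgebra L reduced
  open Plane L L-size reduced (FieldReduction.dimension R)
  open LeftModuleMorphisms.IsLeftModuleHomomorphism using (+ᴹ-homo)

  spreadLine : ∀ {l} → l ∈ S → Direction (Line.carrier l)
  spreadLine {l} l∈S = let isSubspace , dim = proj₁ (proj₂ regular) {l} l∈S in
    record { isSubspace = isSubspace ; hasDimension = dim }

  line : ∀ {W} → Direction W → ∃[ l ] (l ∈ S × Line.carrier l ≐ W)
  line W-direction = proj₂ (proj₂ regular) isSubspace hasDimension
    where open Direction W-direction

  form-+ˡ : ∀ u v w → form (u +ᴹ v) w ≈ form u w + form v w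
  form-+ˡ u v w = +ᴹ-homo (linearˡ w) u v

  form-+ʳ : ∀ u v w → form u (v +ᴹ w) ≈ form u v + form u w
  form-+ʳ u v w = +ᴹ-homo (linearʳ u) v w

  -- Expand `B (v +ᴹ w) (v +ᴹ w)`. The map `B` is arbitrary because the rule is applied both to
  -- `form` and to `form x (a *ₗ y)`.
  polarisation : ∀ (B : Carrierᴹ → Carrierᴹ → Carrier) →
                 (∀ u v w → B (u +ᴹ v) w ≈ B u w + B v w) →
                 (∀ u v w → B u (v +ᴹ w) ≈ B u v + B u w) →
                 (∀ v → B v v ≈ 0#) → ∀ v w → B v w + B w v ≈ 0#
  polarisation B +ˡ +ʳ alt v w = begin
    B v w + B w v                     ≈⟨ +-cong (+-identityˡ _) (+-identityʳ _) ⟨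
    (0# + B v w) + (B w v + 0#)       ≈⟨ +-cong (+-congʳ (alt v)) (+-congˡ (alt w)) ⟨
    (B v v + B v w) + (B w v + B w w) ≈⟨ +-cong (+ʳ v v w) (+ʳ w v w) ⟨
    B v (v +ᴹ w) + B w (v +ᴹ w)       ≈⟨ +ˡ v w (v +ᴹ w) ⟨
    B (v +ᴹ w) (v +ᴹ w)               ≈⟨ alt (v +ᴹ w) ⟩
    0#                                ∎
    where open ≈-Reasoning setoid

  opposite-unique : ∀ {x y z} → x + z ≈ 0# → y + z ≈ 0# → x ≈ y
  opposite-unique {x} {y} {z} x+z≈0 y+z≈0 = ∙-cancelʳ z x y (trans x+z≈0 (sym y+z≈0))
    where open GroupProperties +-group

  form-0ʳ : ∀ {v w} → w ≈ᴹ 0ᴹ → form v w ≈ 0#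
  form-0ʳ {v} {w} w≈0 = x+x≈x⇒x≈0 _ (trans (sym (form-+ʳ v w w))
    (form-cong ≈ᴹ-refl (≈ᴹ-trans (+ᴹ-congˡ w≈0) (+ᴹ-identityʳ w))))
    where open RingProperties ring using (x+x≈x⇒x≈0)

  -- v and a v lie on a common spread line, which is totally isotropic.
  form-multiple : ∀ a v → form v (a *ₗ v) ≈ 0#
  form-multiple a v with ≈0? v
  ... | yes v≈0 = form-0ʳ (≈ᴹ-trans (*ₗ-congˡ v≈0) (*ₗ-zeroʳ a))
  ... | no v≉0 =
    let l , _ , _ , polar⊆l = line (polar-direction v≉0) in
    Line.isotropic l (polar⊆l (det-self v))
      (polar⊆l (IsSubspace.*ₗ-closed (polar-isSubspace v) a (det-self v)))

  -- Both sides are the additive inverse of `form w (a *ₗ v)`: the left by polarising `form`, the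
  -- right by polarising `form x (a *ₗ y)`, which is alternating by `form-multiple`.
  form-adjoint : ∀ a v w → form (a *ₗ v) w ≈ form v (a *ₗ w)
  form-adjoint a v w = opposite-unique
    (polarisation form form-+ˡ form-+ʳ alternating (a *ₗ v) w)
    (polarisation (λ x y → form x (a *ₗ y))
      (λ x y z → form-+ˡ x y (a *ₗ z))
      (λ x y z → trans (form-cong ≈ᴹ-refl (*ₗ-distribˡ a y z)) (form-+ʳ x _ _))
      (form-multiple a) v w)

  form-multiples : ∀ a b v w → form (a *ₗ v) (b *ₗ w) ≈ form v ((a L.* b) *ₗ w)
  form-multiples a b v w = trans (form-adjoint a v (b *ₗ w))
    (form-cong ≈ᴹ-refl (≈ᴹ-sym (*ₗ-assoc a b w)))

  -- In the expansion over the basis the terms pairing `b₀` or `b₁` with itself vanish. Adjointness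
  -- collects the scalars of the two mixed terms on `b₁`, and exchanging the arguments in one of
  -- them produces the minus sign of the determinant.
  form-det : ∀ v w → form v w ≈ form b₀ (det v w *ₗ b₁)
  form-det v w = begin
    form v w
      ≈⟨ form-cong (basis-expansion v) (basis-expansion w) ⟩
    form (v₀ *ₗ b₀ +ᴹ v₁ *ₗ b₁) (w₀ *ₗ b₀ +ᴹ w₁ *ₗ b₁)
      ≈⟨ form-+ˡ _ _ _ ⟩
    form (v₀ *ₗ b₀) (w₀ *ₗ b₀ +ᴹ w₁ *ₗ b₁) + form (v₁ *ₗ b₁) (w₀ *ₗ b₀ +ᴹ w₁ *ₗ b₁)
      ≈⟨ +-cong (form-+ʳ _ _ _) (form-+ʳ _ _ _) ⟩
    (form (v₀ *ₗ b₀) (w₀ *ₗ b₀) + form (v₀ *ₗ b₀) (w₁ *ₗ b₁)) +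
    (form (v₁ *ₗ b₁) (w₀ *ₗ b₀) + form (v₁ *ₗ b₁) (w₁ *ₗ b₁))
      ≈⟨ +-cong (+-cong (isotropic v₀ w₀ b₀) (form-multiples v₀ w₁ b₀ b₁))
                (+-cong opposite (isotropic v₁ w₁ b₁)) ⟩
    (0# + φ (v₀ L.* w₁)) + (φ (L.- v₁ L.* w₀) + 0#)
      ≈⟨ +-cong (+-identityˡ _) (+-identityʳ _) ⟩
    φ (v₀ L.* w₁) + φ (L.- v₁ L.* w₀)
      ≈⟨ φ-+ _ _ ⟨
    φ (v₀ L.* w₁ L.+ L.- v₁ L.* w₀)
      ≈⟨ form-cong ≈ᴹ-refl (*ₗ-congʳ (det-coord v w)) ⟨
    φ (det v w) ∎
    where
    open ≈-Reasoning setoid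
    v₀ = coord v zero
    v₁ = coord v (suc zero)
    w₀ = coord w zero
    w₁ = coord w (suc zero)
    φ : L.Carrier → Carrier
    φ a = form b₀ (a *ₗ b₁)
    φ-+ : ∀ a b → φ (a L.+ b) ≈ φ a + φ b
    φ-+ a b = trans (form-cong ≈ᴹ-refl (*ₗ-distribʳ b₁ a b)) (form-+ʳ b₀ _ _)
    isotropic : ∀ a b v → form (a *ₗ v) (b *ₗ v) ≈ 0#
    isotropic a b v = trans (form-multiples a b v v) (form-multiple _ v)
    opposite : form (v₁ *ₗ b₁) (w₀ *ₗ b₀) ≈ φ (L.- v₁ L.* w₀)
    opposite = opposite-unique
      (polarisation form form-+ˡ form-+ʳ alternating (v₁ *ₗ b₁) (w₀ *ₗ b₀))
      (begin
        φ (L.- v₁ L.* w₀) + form (w₀ *ₗ b₀) (v₁ *ₗ b₁) ≈⟨ +-congˡ (form-multiples w₀ v₁ b₀ b₁) ⟩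
        φ (L.- v₁ L.* w₀) + φ (w₀ L.* v₁)              ≈⟨ φ-+ _ _ ⟨
        φ (L.- v₁ L.* w₀ L.+ w₀ L.* v₁)                ≈⟨ form-0ʳ (≈ᴹ-trans (*ₗ-congʳ cancel) (*ₗ-zeroˡ b₁)) ⟩
        0#                                             ∎)
      where
      cancel : L.- v₁ L.* w₀ L.+ w₀ L.* v₁ L.≈ L.0#
      cancel = L.trans (L.+-congˡ (L.*-comm w₀ v₁)) (L.trans (L.sym (L.distribʳ w₀ (L.- v₁) v₁))
        (L.trans (L.*-congʳ (L.-‿inverseˡ v₁)) (L.zeroˡ w₀)))

  -- By `extends`, a scalar `x` of `K` acts as `ι x`, with which an `L`-linear map commutes.
  restrictLinear : ∀ {g} → IsLinear g → KV.IsLinear g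
  restrictLinear {g} linear = record
    { cong   = cong
    ; +-homo = +-homo
    ; *-homo = λ x v → ≈ᴹ-trans (cong (≈ᴹ-sym (extends x v)))
                         (≈ᴹ-trans (*-homo (ι x) v) (extends x (g v)))
    }
    where open IsLinear linear

  restrictAutomorphism : LinearAutomorphism → KV.LinearAutomorphism
  restrictAutomorphism g = record
    { to = to ; from = from
    ; to-linear = restrictLinear to-linear ; from-linear = restrictLinear from-linear
    ; to∘from = to∘from ; from∘to = from∘to
    }
    where open LinearAutomorphism g

  detIsometry : (g : LinearAutomorphism) → let open LinearAutomorphism g in
                (∀ v w → det (to v) (to w) L.≈ det v w) → Isometry
  detIsometry g det-preserved = record
    { automorphism = restrictAutomorphism g
    ; isometric    = λ v w → trans (form-det (to v) (to w))
        (trans (form-cong ≈ᴹ-refl (*ₗ-congʳ (det-preserved v w))) (sym (form-det v w)))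
    }
    where open LinearAutomorphism g

-- The spread without a line: transitivity and size.

module RemovedLine (K : Field) (f : SymplecticForm K (coordinateSpace K 4)) (q : ℕ)
                   (S : W₃.LineSet K f) (regular : W₃.IsRegular K f q S)
                   (l : W₃.Line K f) (l∈S : l ∈ S) where

  open W₃ K f
  open Isometries K f
  open RegularSpread K f q S regular
  open FieldReduction R using (L; L-size; reduced)
  open LeftModule reduced
  open LinearAlgebra L reduced
  open Plane L L-size reduced (FieldReduction.dimension R)
  open CommutativeRing (FieldProperties.commutativeRing L) hiding (zero)
  open Setoid lines using () renaming (_≈_ to _≈ˡ_)
  private
    module K-space = LinearAlgebra K (coordinateSpace K 4)

  C : Code incidenceGraph
  C = removeLine S l

  -- Regularity provides some spread line with carrier `W`; since `S` respects equality of carriers,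
  -- `m` itself belongs to it.
  spreadLine-∈ : ∀ m {W} → Direction W → Line.carrier m ≐ W → m ∈ S
  spreadLine-∈ m W-direction m≐W = let k , k∈S , k≐W = line W-direction in
    Subset.respect S {k} {m} (≐-trans k≐W (≐-sym m≐W)) k∈S

  module _ {p p′} (t : Transport (Line.carrier l) p p′) where
    open Transport t

    isometry : Isometry
    isometry = detIsometry automorphism det-preserved

    -- An `L`-linear automorphism permutes the directions, hence the spread lines; fixing `l` as a
    -- set, it also preserves being different from `l`.
    stabilises : Stabilises incidenceGraph (graphAutomorphism isometry) C
    stabilises (inj₁ _) = mk⇔ id id
    stabilises (inj₂ m) = mk⇔
      (λ (m∈S , m≉l) →
        spreadLine-∈ (Isometry.mapLine isometry m)
          -- Restriction of scalars keeps `from`, so the images over `K` and over `L` are the same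
          -- predicate by definition.
          (image-direction automorphism (spreadLine {m} m∈S)) (id , id) ,
        λ (gm⊆l , l⊆gm) → m≉l
          ( (λ v∈m → l.resp (from∘to _) (proj₂ image-fixed (gm⊆l (m.resp (≈ᴹ-sym (from∘to _)) v∈m))))
          , (λ v∈l → m.resp (from∘to _) (l⊆gm (proj₁ image-fixed (l.resp (≈ᴹ-sym (from∘to _)) v∈l))))))
      -- Conversely, the inverse automorphism carries the direction of the image line back to `m`,
      -- up to `from∘to`.
      (λ (gm∈S , gm≉l) →
        spreadLine-∈ m
          (image-direction (inverse automorphism) (spreadLine {Isometry.mapLine isometry m} gm∈S))
          (m.resp (≈ᴹ-sym (from∘to _)) , m.resp (from∘to _)) ,
        λ (m⊆l , l⊆m) → gm≉l
          ( (λ v∈ → proj₁ image-fixed (m⊆l v∈)) , (λ v∈ → l⊆m (proj₂ image-fixed v∈))))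
      where
      module l = IsSubspace (Line.isSubspace l)
      module m = IsSubspace (Line.isSubspace m)

  open Removed (spreadLine {l} l∈S)

  transitive : StabiliserTransitiveOn incidenceGraph C C
  transitive {inj₁ _} {_} ()
  transitive {inj₂ _} {inj₁ _} _ ()
  transitive {inj₂ m} {inj₂ m′} (m∈S , m≉l) (m′∈S , m′≉l) =
    graphAutomorphism (isometry t) , stabilises t ,
    inj₂ (Transport.image-generator t m.isSubspace m′.isSubspace m.hasDimension m′.hasDimension
      (Transport.moves t))
    where
    module m = Direction (spreadLine {m} m∈S)
    module m′ = Direction (spreadLine {m′} m′∈S)
    t : Transport (Line.carrier l) m.generator m′.generator
    t = transport (off (spreadLine {m} m∈S) m≉l m.generator∈ m.generator≉0)
                  (off (spreadLine {m′} m′∈S) m′≉l m′.generator∈ m′.generator≉0)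

  point-off : ∀ P m → m ∈ S → ¬ m ≈ˡ l → P on m →
              Off (K-space.Generator.generator (Point.dimension P))
  point-off P m m∈S m≉l P⊆m = off (spreadLine {m} m∈S) m≉l (P⊆m generator∈) generator≉0
    where open K-space.Generator (Point.dimension P)

  -- The code contains only lines, so its neighbours are points and the other cases are absurd. A
  -- point is spanned over `K` by a vector off `l`, and the `L`-linear map between two such vectors
  -- is in particular `K`-linear.
  neighbour-transitive : StabiliserTransitiveOn incidenceGraph C (neighbours incidenceGraph C)
  neighbour-transitive {_} {_} (_ , inj₁ _ , () , _) _
  neighbour-transitive {inj₂ _} {_} (_ , inj₂ _ , _ , ()) _
  neighbour-transitive {inj₁ _} {_} (_ , inj₂ _ , _) (_ , inj₁ _ , () , _)
  neighbour-transitive {inj₁ _} {inj₂ _} (_ , inj₂ _ , _) (_ , inj₂ _ , _ , ())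
  neighbour-transitive {inj₁ P} {inj₁ P′} (_ , inj₂ m , (m∈S , m≉l) , P⊆m)
                                          (_ , inj₂ m′ , (m′∈S , m′≉l) , P′⊆m′) =
    graphAutomorphism (isometry t) , stabilises t ,
    inj₁ (K-space.LinearAutomorphism.image-generator (restrictAutomorphism (Transport.automorphism t))
      P.isSubspace P′.isSubspace P.dimension P′.dimension (Transport.moves t))
    where
    module P = Point P
    module P′ = Point P′
    t : Transport (Line.carrier l) (K-space.Generator.generator P.dimension)
                                   (K-space.Generator.generator P′.dimension)
    t = transport (point-off P m m∈S m≉l P⊆m) (point-off P′ m′ m′∈S m′≉l P′⊆m′)

  affineLine : ∀ a → ∃[ m ] (m ∈ S × Line.carrier m ≐ polar (affine a))
  affineLine a = line (polar-direction (affine≉0 a))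

  -- A line corresponds to the parameter of its intersection with the affine line. Well-definedness
  -- and one inverse law come from `affine-injective`; the other inverse law holds because the two
  -- lines share a nonzero vector.
  elements↔L : Inverse (elements C) (fieldSetoid L)
  elements↔L = record
    { to        = to
    ; from      = from
    ; to-cong   = λ {x} {y} → to-cong {x} {y}
    ; from-cong = λ {a} {b} → from-cong {a} {b}
    ; inverse   = (λ {a} {x} → inverseˡ {a} {x}) , (λ {x} {a} → inverseʳ {x} {a})
    }
    where
    open Setoid (elements C) using () renaming (Carrier to Element; _≈_ to _≈ᵉ_)

    meets : ∀ {m} → m ∈ S → ¬ m ≈ˡ l → ∃[ a ] Line.carrier m (affine a)
    meets {m} m∈S m≉l = affine-meets (spreadLine {m} m∈S) m≉l

    to : Element → Carrier
    to (inj₁ _ , ())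
    to (inj₂ m , m∈S , m≉l) = proj₁ (meets {m} m∈S m≉l)

    from : Carrier → Element
    from a = let m , m∈S , _ , polar⊆m = affineLine a in
      -- The line through `affine a` is not the removed one, since `l` misses the affine line.
      inj₂ m , m∈S , λ (m⊆l , _) → affine∉W a (m⊆l (polar⊆m (det-self (affine a))))

    to-cong : ∀ {x y} → x ≈ᵉ y → to x ≈ to y
    to-cong {inj₁ _ , ()}
    to-cong {inj₂ m , m∈S , m≉l} {inj₂ m′ , m′∈S , m′≉l} (inj₂ (m⊆m′ , _)) =
      affine-injective (spreadLine {m′} m′∈S)
        (m⊆m′ (proj₂ (meets {m} m∈S m≉l))) (proj₂ (meets {m′} m′∈S m′≉l))

    from-cong : ∀ {a b} → a ≈ b → from a ≈ᵉ from b
    from-cong {a} {b} a≈b = inj₂ (≐-trans (proj₂ (proj₂ (affineLine a)))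
      (≐-trans (polar-cong (affine-cong a≈b)) (≐-sym (proj₂ (proj₂ (affineLine b))))))

    inverseˡ : ∀ {a x} → x ≈ᵉ from a → to x ≈ a
    inverseˡ {a} {inj₁ _ , ()}
    inverseˡ {a} {inj₂ m , m∈S , m≉l} (inj₂ (m⊆ , _)) = let _ , _ , ⊆polar , _ = affineLine a in
      affine-injective (polar-direction (affine≉0 a))
        (⊆polar (m⊆ (proj₂ (meets {m} m∈S m≉l)))) (det-self (affine a))

    inverseʳ : ∀ {x a} → a ≈ to x → from a ≈ᵉ x
    inverseʳ {inj₁ _ , ()}
    inverseʳ {inj₂ m , m∈S , m≉l} {a} a≈ = inj₂ (≐-trans (proj₂ (proj₂ (affineLine a)))
      (≐-trans (polar-cong (affine-cong a≈))
        (≐-sym (Direction.≐polar (spreadLine {m} m∈S) (affine≉0 _) (proj₂ (meets {m} m∈S m≉l))))))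

lemma4p3 : (q : ℕ) → IsPrimePower q →
    (K : Field) → HasSize (fieldSetoid K) q →
    (f : SymplecticForm K (coordinateSpace K 4)) →
    let open W₃ K f in
    (S : LineSet) → IsSpread S → IsRegular q S →
    (l : Line) → l ∈ S →
    IsNeighbourTransitive incidenceGraph (removeLine S l) ×
    HasSize (elements (removeLine S l)) (q ^ 2)
lemma4p3 q _ K _ f S _ regular l l∈S =
  ((λ {x} {y} → transitive {x} {y}) , λ {x} {y} → neighbour-transitive {x} {y}) ,
  Composition.inverse elements↔L (FieldReduction.L-size R)
  where
  open RemovedLine K f q S regular l l∈S
  open RegularSpread K f q S regular using (R)
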